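{- The inverse map of $\alpha:\mathrm{Tree}\to\mathrm{End}$ is $\bar\alpha:\mathrm{End}\to\mathrm{Tree}$. That is, for every $n\ge 0$, $\alpha\circ\bar\alpha$ is the identity on $\mathrm{End}_n$ and $\bar\alpha\circ\alpha$ is the identity on $\mathrm{Tree}_n$.
   Context: Write $[n]=\{1,\dots,n\}$. $\mathrm{End}_n$ is the set of endofunctions $x:[n]\to[n]$, identified with words $x=x_1\dots x_n$, $x_i=x(i)$; $\mathrm{End}=\bigcup_{n\ge0}\mathrm{End}_n$. A binary tree is either empty or a triple $T=(L,r,R)$ with $r$ a node (the root) and $L,R$ binary trees (left and right subtree). $V(T)$ is the set of nodes and the size of $T$ is $|V(T)|$. A vertex labeling is a map $\mathfrak{l}:V(T)\to\{1,2,\dots\}$; $\max(T)$ is the largest label, with $\max(\emptyset)=0$. Labeled binary trees are considered up to label-preserving isomorphism of binary trees. $T$ is decreasing if it is empty, or $T=(L,r,R)$ with $L,R$ decreasing and $\mathfrak{l}(r)\ge\max\{\max(L),\max(R)\}$. $T$ is strictly decreasing to the left if it is empty, or $T=(L,r,R)$ with $\mathfrak{l}(r)>\max(L)$ and $L,R$ strictly decreasing to the left. An endotree of size $n$ is a decreasing binary tree of size $n$ that is strictly decreasing to the left and has all labels in $[n]$. $\mathrm{Tree}_n$ is the set of endotrees of size $n$ and $\mathrm{Tree}=\bigcup_{n\ge0}\mathrm{Tree}_n$. The in-order sequence $\alpha(T)$ of a labeled binary tree is the empty word if $T$ is empty, and $\alpha(T)=\alpha(L)\,\mathfrak{l}(r)\,\alpha(R)$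 (concatenation) if $T=(L,r,R)$; it maps $\mathrm{Tree}_n$ to $\mathrm{End}_n$. The max-decomposition of a nonempty word $x=x_1\dots x_n$ of positive integers is $x=\mathrm{pref}(x)\,x_m\,\mathrm{suff}(x)$, where $m$ is the index of the leftmost occurrence of $\max_i x_i$, $\mathrm{pref}(x)=x_1\dots x_{m-1}$ and $\mathrm{suff}(x)=x_{m+1}\dots x_n$. The tree $\bar\alpha(x)$ is empty if $x$ is empty; otherwise $\bar\alpha(x)=(L,r,R)$ with $\mathfrak{l}(r)=x_m$, $L=\bar\alpha(\mathrm{pref}(x))$, $R=\bar\alpha(\mathrm{suff}(x))$. -}

module Defs where

open import Data.Fin.Base using (Fin; toℕ)
open import Data.List.Base
  using (List; []; _∷_; _++_; length; foldr; tabulate; takeWhile; dropWhile; drop)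
open import Data.List.Membership.Propositional using (_∈_)
open import Data.List.Properties using (length-++)
open import Data.List.Relation.Unary.Any using (here; there)
open import Data.Nat.Base using (ℕ; suc; _+_; _⊔_; _≤_; _<_; _≥_; _>_)
open import Data.Nat.Induction using (Acc; acc; <-wellFounded)
open import Data.Nat.Properties
  using (_≟_; ⊔-sel; ⊔-identityʳ; ≤-trans; ≤-reflexive; m<m+n; m≤n+m; 0<1+n)
open import Data.Product.Base using (∃; _×_)
open import Data.Sum.Base using (inj₁; inj₂)
open import Data.Tree.Binary using (Tree; leaf; node; #nodes)
open import Data.Tree.Binary.Relation.Unary.All using (All)
open import Data.Unit.Base using (⊤)
open import Function.Base using (_∘_)
open import Level using (0ℓ)
open import Relation.Binary.PropositionalEquality
  using (_≡_; _≢_; refl; sym; trans; cong; cong₂; subst)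
open import Relation.Nullary.Decidable using (yes; no; ¬?; decidable-stable)
open import Relation.Nullary.Negation using (contradiction)
open import Relation.Unary using (Pred; Decidable; U)

Word : Set
Word = List ℕ

-- The set [n] = {1,…,n} is represented by Fin n, with i standing for suc (toℕ i).
word : ∀ {n} → (Fin n → Fin n) → Word
word x = tabulate (suc ∘ toℕ ∘ x)

-- Endofunctions of [n], identified with their words x₁…xₙ.
End : ℕ → Pred Word 0ℓ
End n w = ∃ λ (x : Fin n → Fin n) → w ≡ word x

-- Nodes carry their labels and leaves carry nothing, so _≡_ on this type is
-- label-preserving isomorphism; `leaf _` is the empty tree.  Labels range over ℕ;
-- that they are positive is part of Endotree.
LabeledTree : Set
LabeledTree = Tree ℕ ⊤

maxLabel : LabeledTree → ℕ
maxLabel (leaf _)     = 0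
maxLabel (node L r R) = maxLabel L ⊔ r ⊔ maxLabel R

data Decreasing : Pred LabeledTree 0ℓ where
  leaf : ∀ {e} → Decreasing (leaf e)
  node : ∀ {L r R} → Decreasing L → r ≥ maxLabel L ⊔ maxLabel R → Decreasing R →
         Decreasing (node L r R)

data StrictlyDecreasingLeft : Pred LabeledTree 0ℓ where
  leaf : ∀ {e} → StrictlyDecreasingLeft (leaf e)
  node : ∀ {L r R} → StrictlyDecreasingLeft L → r > maxLabel L →
         StrictlyDecreasingLeft R → StrictlyDecreasingLeft (node L r R)

record Endotree (n : ℕ) (T : LabeledTree) : Set where
  field
    size                   : #nodes T ≡ n
    decreasing             : Decreasing T
    strictlyDecreasingLeft : StrictlyDecreasingLeft T
    labels∈[n]             : All (λ l → 1 ≤ l × l ≤ n) U T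

α : LabeledTree → Word
α (leaf _)     = []
α (node L r R) = α L ++ r ∷ α R

maximum : Word → ℕ
maximum = foldr _⊔_ 0

-- `before v w` and `after v w` are the parts of w on either side of the leftmost
-- occurrence of v in w.
before after : ℕ → Word → Word
before v w = takeWhile (λ a → ¬? (a ≟ v)) w
after  v w = drop 1 (dropWhile (λ a → ¬? (a ≟ v)) w)

-- The parts of w before and after its leftmost maximal letter; that letter is
-- `maximum w` when w is nonempty (see max-decomposition).
pref suff : Word → Word
pref w = before (maximum w) w
suff w = after (maximum w) w

split-at-leftmost : ∀ {v} (≢v? : Decidable (_≢ v)) {w} → v ∈ w →
                    w ≡ takeWhile ≢v? w ++ v ∷ drop 1 (dropWhile ≢v? w)
split-at-leftmost ≢v? {a ∷ w} v∈ with ≢v? a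
split-at-leftmost ≢v? {a ∷ w} (here v≡a) | yes a≢v = contradiction (sym v≡a) a≢v
split-at-leftmost ≢v? {a ∷ w} (there v∈) | yes a≢v = cong (a ∷_) (split-at-leftmost ≢v? v∈)
split-at-leftmost ≢v? {a ∷ w} v∈         | no ¬a≢v =
  cong (_∷ w) (decidable-stable (a ≟ _) ¬a≢v)

maximum∈ : ∀ a w → maximum (a ∷ w) ∈ a ∷ w
maximum∈ a []      = here (⊔-identityʳ a)
maximum∈ a (b ∷ w) with ⊔-sel a (maximum (b ∷ w))
... | inj₁ ≡a = here ≡a
... | inj₂ ≡m = there (subst (_∈ b ∷ w) (sym ≡m) (maximum∈ b w))

max-decomposition : ∀ a w → let x = a ∷ w in x ≡ pref x ++ maximum x ∷ suff x
max-decomposition a w =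
  split-at-leftmost (λ b → ¬? (b ≟ maximum (a ∷ w))) (maximum∈ a w)

length-decomposition : ∀ a w → let x = a ∷ w in
                       length x ≡ length (pref x) + suc (length (suff x))
length-decomposition a w =
  trans (cong length (max-decomposition a w)) (length-++ (pref (a ∷ w)))

pref-shorter : ∀ a w → length (pref (a ∷ w)) < length (a ∷ w)
pref-shorter a w =
  ≤-trans (m<m+n _ 0<1+n) (≤-reflexive (sym (length-decomposition a w)))

suff-shorter : ∀ a w → length (suff (a ∷ w)) < length (a ∷ w)
suff-shorter a w =
  ≤-trans (m≤n+m _ (length (pref (a ∷ w)))) (≤-reflexive (sym (length-decomposition a w)))

ᾱ-acc : (w : Word) → Acc _<_ (length w) → LabeledTree
ᾱ-acc []      _        = leaf _
ᾱ-acc (a ∷ w) (acc rs) =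
  node (ᾱ-acc (pref (a ∷ w)) (rs (pref-shorter a w)))
       (maximum (a ∷ w))
       (ᾱ-acc (suff (a ∷ w)) (rs (suff-shorter a w)))

ᾱ : Word → LabeledTree
ᾱ w = ᾱ-acc w (<-wellFounded (length w))

ᾱ-acc-irrelevant : ∀ w (p q : Acc _<_ (length w)) → ᾱ-acc w p ≡ ᾱ-acc w q
ᾱ-acc-irrelevant []      _        _        = refl
ᾱ-acc-irrelevant (a ∷ w) (acc rs) (acc ss) =
  cong₂ (λ L R → node L (maximum (a ∷ w)) R)
    (ᾱ-acc-irrelevant (pref (a ∷ w)) (rs (pref-shorter a w)) (ss (pref-shorter a w)))
    (ᾱ-acc-irrelevant (suff (a ∷ w)) (rs (suff-shorter a w)) (ss (suff-shorter a w)))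

ᾱ-acc-nonempty : ∀ a w (p : Acc _<_ (length (a ∷ w))) → let x = a ∷ w in
                 ᾱ-acc x p ≡ node (ᾱ (pref x)) (maximum x) (ᾱ (suff x))
ᾱ-acc-nonempty a w (acc rs) =
  cong₂ (λ L R → node L (maximum (a ∷ w)) R)
    (ᾱ-acc-irrelevant (pref (a ∷ w)) (rs (pref-shorter a w)) (<-wellFounded _))
    (ᾱ-acc-irrelevant (suff (a ∷ w)) (rs (suff-shorter a w)) (<-wellFounded _))

ᾱ-nonempty : ∀ a w → let x = a ∷ w in ᾱ x ≡ node (ᾱ (pref x)) (maximum x) (ᾱ (suff x))
ᾱ-nonempty a w = ᾱ-acc-nonempty a w (<-wellFounded _)

{-# OPTIONS --safe #-}

-- α ∘ ᾱ ≡ id is the max-decomposition x ≡ pref x ++ maximum x ∷ suff x applied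
-- recursively.  Conversely, the two decreasing conditions at the root of node L r R say
-- that maximum (α L) < r and maximum (α R) ≤ r, which is exactly what makes
-- α L ++ r ∷ α R the max-decomposition of this word.  Since α preserves sizes and labels,
-- all remaining conditions transfer between a tree and its in-order word.

module Submission where

open import Data.Fin.Base using (Fin; toℕ; fromℕ<)
open import Data.Fin.Properties using (toℕ<n; toℕ-fromℕ<)
open import Data.List.Base using ([]; _∷_; _++_; length; tabulate; drop; takeWhile; dropWhile)
open import Data.List.Properties
  using (length-++; length-tabulate; foldr-forcesᵇ; foldr-preservesᵇ)
import Data.List.Relation.Unary.All as All
open All using (All; []; _∷_)
open import Data.List.Relation.Unary.All.Properties
  using (++⁺; ++⁻; takeWhile⁺; all-takeWhile; tabulate⁺)
open import Data.Nat.Base using (ℕ; suc; _+_; _⊔_; _≤_; _<_; z≤n; s≤s)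
open import Data.Nat.Induction using (<-wellFounded; Acc; acc)
open import Data.Nat.Properties
open import Data.Product.Base using (_×_; _,_; proj₁; ∃)
open import Data.Tree.Binary using (leaf; node; #nodes)
import Data.Tree.Binary.Relation.Unary.All as Tree
open import Data.Vec.Functional using () renaming (_∷_ to _∷ᶠ_)
open import Function.Base using (_∘_)
open import Relation.Binary.PropositionalEquality
open import Relation.Nullary.Decidable using (yes; no; ¬?)
open import Relation.Nullary.Negation using (¬_; contradiction)
open import Relation.Unary using (Pred; Decidable; U; _∈_)
open import Level using (0ℓ)
open import Defs

-- `pref x` and `suff x` are not structural subterms of `x`, so the recursion descends on word
-- length. Packaging it here keeps accessibility proofs out of the later arguments.
max-induction : (P : Pred Word 0ℓ) → P [] →
                (∀ a w → let x = a ∷ w in P (pref x) → P (suff x) → P x) →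
                ∀ w → P w
max-induction P base step w = go w (<-wellFounded (length w))
  where
  go : ∀ w → Acc _<_ (length w) → P w
  go []      _        = base
  go (a ∷ w) (acc rs) = step a w (go _ (rs (pref-shorter a w))) (go _ (rs (suff-shorter a w)))

letters≤maximum : ∀ w → All (_≤ maximum w) w
letters≤maximum w =
  -- A bound on a join bounds both arguments, so the trivial bound of `maximum w` by itself descends
  -- through the fold to every letter.
  foldr-forcesᵇ (λ m n m⊔n≤ → m⊔n≤o⇒m≤o m n m⊔n≤ , m⊔n≤o⇒n≤o m n m⊔n≤) 0 w ≤-refl

-- The premise `0 < m` accounts for the starting value 0 of the fold.
maximum-< : ∀ {m w} → 0 < m → All (_< m) w → maximum w < m
maximum-< = foldr-preservesᵇ ⊔-pres-<m

maximum-≤ : ∀ {m w} → All (_≤ m) w → maximum w ≤ m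
maximum-≤ = foldr-preservesᵇ ⊔-lub z≤n

maximum-++ : ∀ u v → maximum (u ++ v) ≡ maximum u ⊔ maximum v
maximum-++ []      v = refl
maximum-++ (a ∷ u) v =
  trans (cong (a ⊔_) (maximum-++ u v)) (sym (⊔-assoc a (maximum u) (maximum v)))

-- Positivity is needed when pref x is empty, as maximum [] is 0.
maximum-pref< : ∀ a w → let x = a ∷ w in All (1 ≤_) x → maximum (pref x) < maximum x
maximum-pref< a w 1≤x =
  maximum-< (All.lookup 1≤x (maximum∈ a w))
    (All.zipWith (λ (b≤m , b≢m) → ≤∧≢⇒< b≤m b≢m)
      ( takeWhile⁺ ≢m? (letters≤maximum (a ∷ w))
      , all-takeWhile ≢m? (a ∷ w)))
  where
  ≢m? : Decidable (_≢ maximum (a ∷ w))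
  ≢m? b = ¬? (b ≟ maximum (a ∷ w))

All-decomposition : ∀ {P : Pred ℕ 0ℓ} a w → let x = a ∷ w in
                    All P x → All P (pref x) × P (maximum x) × All P (suff x)
All-decomposition {P} a w all
  with ++⁻ (pref (a ∷ w)) (subst (All P) (max-decomposition a w) all)
... | pp , pm ∷ ps = pp , pm , ps

maximum-suff≤ : ∀ a w → let x = a ∷ w in maximum (suff x) ≤ maximum x
maximum-suff≤ a w with All-decomposition a w (letters≤maximum (a ∷ w))
... | _ , _ , suff≤ = maximum-≤ suff≤

maximum-decomposed : ∀ u {r} v → maximum u < r → maximum v ≤ r → maximum (u ++ r ∷ v) ≡ r
maximum-decomposed u {r} v u<r v≤r = begin
  maximum (u ++ r ∷ v)          ≡⟨ maximum-++ u (r ∷ v) ⟩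
  maximum u ⊔ (r ⊔ maximum v)   ≡⟨ cong (maximum u ⊔_) (m≥n⇒m⊔n≡m v≤r) ⟩
  maximum u ⊔ r                 ≡⟨ m≤n⇒m⊔n≡n (<⇒≤ u<r) ⟩
  r                             ∎
  where open ≡-Reasoning

module _ {P : Pred ℕ 0ℓ} (P? : Decidable P) where

  takeWhile-++-∷ : ∀ {u v} w → All P u → ¬ P v → takeWhile P? (u ++ v ∷ w) ≡ u
  takeWhile-++-∷ {v = v} w [] ¬pv with P? v
  ... | yes pv = contradiction pv ¬pv
  ... | no _   = refl
  takeWhile-++-∷ w (_∷_ {a} pa pu) ¬pv with P? a
  ... | yes _  = cong (a ∷_) (takeWhile-++-∷ w pu ¬pv)
  ... | no ¬pa = contradiction pa ¬pa

  dropWhile-++-∷ : ∀ {u v} w → All P u → ¬ P v → dropWhile P? (u ++ v ∷ w) ≡ v ∷ w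
  dropWhile-++-∷ {v = v} w [] ¬pv with P? v
  ... | yes pv = contradiction pv ¬pv
  ... | no _   = refl
  dropWhile-++-∷ w (_∷_ {a} pa pu) ¬pv with P? a
  ... | yes _  = dropWhile-++-∷ w pu ¬pv
  ... | no ¬pa = contradiction pa ¬pa

before-++ : ∀ {u v} w → All (_≢ v) u → before v (u ++ v ∷ w) ≡ u
before-++ {v = v} w u≢v = takeWhile-++-∷ (λ a → ¬? (a ≟ v)) w u≢v (λ v≢v → v≢v refl)

after-++ : ∀ {u v} w → All (_≢ v) u → after v (u ++ v ∷ w) ≡ w
after-++ {v = v} w u≢v =
  cong (drop 1) (dropWhile-++-∷ (λ a → ¬? (a ≟ v)) w u≢v (λ v≢v → v≢v refl))

-- The bounds make `r` the maximum of the whole word, and strictness on `u` makes the displayed `r`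
-- its leftmost occurrence. Hence `before` and `after` cut the word exactly there.
ᾱ-decomposed : ∀ {u r v} → maximum u < r → maximum v ≤ r →
               ᾱ (u ++ r ∷ v) ≡ node (ᾱ u) r (ᾱ v)
ᾱ-decomposed {u} {r} {v} u<r v≤r = begin
  ᾱ x                                          ≡⟨ unfold u ⟩
  -- `pref` and `suff` unfold to `before` and `after` at `maximum x`, so one rewrite replaces the
  -- cutting value and the root label together.
  node (ᾱ (pref x)) (maximum x) (ᾱ (suff x))   ≡⟨ cong (λ m → node (ᾱ (before m x)) m (ᾱ (after m x)))
                                                       (maximum-decomposed u v u<r v≤r) ⟩
  node (ᾱ (before r x)) r (ᾱ (after r x))      ≡⟨ cong₂ (λ p s → node (ᾱ p) r (ᾱ s))
                                                        (before-++ v u≢r) (after-++ v u≢r) ⟩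
  node (ᾱ u) r (ᾱ v)                           ∎
  where
  open ≡-Reasoning
  x = u ++ r ∷ v

  u≢r : All (_≢ r) u
  u≢r = All.map (λ a≤m → <⇒≢ (≤-<-trans a≤m u<r)) (letters≤maximum u)

  -- Splitting on `u` exposes the first letter that `ᾱ-nonempty` expects.
  unfold : ∀ u → let x = u ++ r ∷ v in ᾱ x ≡ node (ᾱ (pref x)) (maximum x) (ᾱ (suff x))
  unfold []      = ᾱ-nonempty r v
  unfold (a ∷ u) = ᾱ-nonempty a (u ++ r ∷ v)

α-ᾱ : ∀ w → α (ᾱ w) ≡ w
α-ᾱ = max-induction _ refl λ a w αᾱ-pref αᾱ-suff → let x = a ∷ w in begin
  α (ᾱ x)                                       ≡⟨ cong α (ᾱ-nonempty a w) ⟩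
  α (ᾱ (pref x)) ++ maximum x ∷ α (ᾱ (suff x))  ≡⟨ cong₂ (λ p s → p ++ maximum x ∷ s) αᾱ-pref αᾱ-suff ⟩
  pref x ++ maximum x ∷ suff x                  ≡⟨ max-decomposition a w ⟨
  x                                             ∎
  where open ≡-Reasoning

-- This translates the order conditions at a node into conditions on the in-order words of its
-- subtrees, and back.
maxLabel≡maximum-α : ∀ T → maxLabel T ≡ maximum (α T)
maxLabel≡maximum-α (leaf _)     = refl
maxLabel≡maximum-α (node L r R) = begin
  maxLabel L ⊔ r ⊔ maxLabel R             ≡⟨ ⊔-assoc (maxLabel L) r (maxLabel R) ⟩
  maxLabel L ⊔ (r ⊔ maxLabel R)           ≡⟨ cong₂ (λ l m → l ⊔ (r ⊔ m)) (maxLabel≡maximum-α L)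
                                                                         (maxLabel≡maximum-α R) ⟩
  maximum (α L) ⊔ (r ⊔ maximum (α R))     ≡⟨ maximum-++ (α L) (r ∷ α R) ⟨
  maximum (α L ++ r ∷ α R)                ∎
  where open ≡-Reasoning

maxLabel-ᾱ : ∀ w → maxLabel (ᾱ w) ≡ maximum w
maxLabel-ᾱ w = trans (maxLabel≡maximum-α (ᾱ w)) (cong maximum (α-ᾱ w))

length-α : ∀ T → length (α T) ≡ #nodes T
length-α (leaf _)     = refl
length-α (node L r R) =
  trans (length-++ (α L)) (cong₂ (λ l m → l + suc m) (length-α L) (length-α R))

All-α⁺ : ∀ {P : Pred ℕ 0ℓ} {T} → Tree.All P U T → All P (α T)
All-α⁺ (Tree.leaf _)       = []
All-α⁺ (Tree.node pL pr pR) = ++⁺ (All-α⁺ pL) (pr ∷ All-α⁺ pR)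

All-α⁻ : ∀ {P : Pred ℕ 0ℓ} T → All P (α T) → Tree.All P U T
All-α⁻ (leaf _)     _   = Tree.leaf _
All-α⁻ (node L r R) all with ++⁻ (α L) all
... | pL , pr ∷ pR = Tree.node (All-α⁻ L pL) pr (All-α⁻ R pR)

-- Cutting at the leftmost maximum gives a strict bound on the left and a weak one on the right.
-- Positivity passes to both parts, so it is carried inside the induction predicate.
ᾱ-decreasing : ∀ w → All (1 ≤_) w → Decreasing (ᾱ w) × StrictlyDecreasingLeft (ᾱ w)
ᾱ-decreasing = max-induction D (λ _ → leaf , leaf) step
  where
  D : Pred Word 0ℓ
  D w = All (1 ≤_) w → Decreasing (ᾱ w) × StrictlyDecreasingLeft (ᾱ w)

  step : ∀ a w → let x = a ∷ w in D (pref x) → D (suff x) → D x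
  step a w D-pref D-suff 1≤x rewrite ᾱ-nonempty a w
    with All-decomposition a w 1≤x
  ... | 1≤p , _ , 1≤s with D-pref 1≤p | D-suff 1≤s
  ...   | dL , sL | dR , sR = node dL (⊔-lub (<⇒≤ L<) R≤) dR , node sL L< sR
    where
    L< : maxLabel (ᾱ (pref (a ∷ w))) < maximum (a ∷ w)
    L< = ≤-<-trans (≤-reflexive (maxLabel-ᾱ (pref (a ∷ w)))) (maximum-pref< a w 1≤x)

    R≤ : maxLabel (ᾱ (suff (a ∷ w))) ≤ maximum (a ∷ w)
    R≤ = ≤-trans (≤-reflexive (maxLabel-ᾱ (suff (a ∷ w)))) (maximum-suff≤ a w)

ᾱ-α : ∀ {T} → Decreasing T → StrictlyDecreasingLeft T → ᾱ (α T) ≡ T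
ᾱ-α leaf leaf = refl
ᾱ-α (node {L} {r} {R} dL r≥ dR) (node sL r>L sR) =
  trans (ᾱ-decomposed (subst (_< r) (maxLabel≡maximum-α L) r>L)
                      (subst (_≤ r) (maxLabel≡maximum-α R) (m⊔n≤o⇒n≤o (maxLabel L) _ r≥)))
        (cong₂ (λ L R → node L r R) (ᾱ-α dL sL) (ᾱ-α dR sR))

-- The domain `Fin (length w)` is kept apart from the codomain `Fin n`: the induction shortens the
-- former and fixes the latter. `End⁺` then identifies the two sizes.
letters⇒End : ∀ {n} w → All (λ l → 1 ≤ l × l ≤ n) w →
              ∃ λ (x : Fin (length w) → Fin n) → w ≡ tabulate (suc ∘ toℕ ∘ x)
letters⇒End []      []                         = (λ ()) , refl
-- Positivity exposes the letter as `suc k`; its upper bound `suc k ≤ n` is by definition `k < n`,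
-- which yields the index in `Fin n`.
letters⇒End (_ ∷ w) ((s≤s z≤n , k<n) ∷ letters) with letters⇒End w letters
... | x , w≡x = fromℕ< k<n ∷ᶠ x , cong₂ _∷_ (cong suc (sym (toℕ-fromℕ< k<n))) w≡x

End⁺ : ∀ {n} w → length w ≡ n → All (λ l → 1 ≤ l × l ≤ n) w → w ∈ End n
End⁺ w refl = letters⇒End w

End⁻ : ∀ {n w} → w ∈ End n → length w ≡ n × All (λ l → 1 ≤ l × l ≤ n) w
End⁻ (x , refl) = length-tabulate _ , tabulate⁺ (λ i → s≤s z≤n , toℕ<n (x i))

-- Size and label range depend only on the in-order word, and that word is `w` by `α-ᾱ`; the order
-- conditions come from `ᾱ-decreasing`.
ᾱ-endotree : ∀ {n} w → w ∈ End n → ᾱ w ∈ Endotree n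
ᾱ-endotree w w∈ with End⁻ w∈
... | len , letters with ᾱ-decreasing w (All.map proj₁ letters)
...   | dec , sdl = record
  { size                   = trans (sym (length-α (ᾱ w))) (trans (cong length (α-ᾱ w)) len)
  ; decreasing             = dec
  ; strictlyDecreasingLeft = sdl
  ; labels∈[n]             = All-α⁻ (ᾱ w) (subst (All _) (sym (α-ᾱ w)) letters)
  }

proposition2p3 : ∀ (n : ℕ) →
    (∀ w → w ∈ End n → ᾱ w ∈ Endotree n × α (ᾱ w) ≡ w) ×
    (∀ T → T ∈ Endotree n → α T ∈ End n × ᾱ (α T) ≡ T)
proposition2p3 n = (λ w w∈ → ᾱ-endotree w w∈ , α-ᾱ w) ,
  λ T T∈ → let open Endotree T∈ in
    End⁺ (α T) (trans (length-α T) size) (All-α⁺ labels∈[n]) ,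
    ᾱ-α decreasing strictlyDecreasingLeft
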